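{- Let $M$ be a simple matroid on $[n]$ of rank $\ell\ge 3$. If the Orlik–Solomon algebra $A(M)=E/I(M)$ is quadratic, then $M$ is $3$-independent.
   Context: $R$ is an arbitrary nonzero commutative ring with $1$. A simple matroid has no loops and no nontrivial parallel classes; $[n]=\{1,\dots,n\}$. $E$ is the exterior algebra over $R$ on the free $R$-module with basis $e_1,\dots,e_n$, with the standard grading. For $S=\{i_1<\dots<i_p\}\subset[n]$ put $e_S=e_{i_1}\cdots e_{i_p}$ ($e_\emptyset=1$). $\partial:E\to E$ is the $R$-linear map of degree $-1$ with $\partial e_i=1$ for all $i$ and $\partial(ab)=(\partial a)b+(-1)^{\deg a}a\,\partial b$ for homogeneous $a$ and all $b$. The Orlik–Solomon ideal $I(M)$ is the (graded) ideal of $E$ generated by $\partial e_S$ for all dependent sets $S$ of $M$. $A(M)$ is quadratic if $I(M)$ is generated as an ideal by its degree $2$ component $I(M)\cap E_2$. For $3\le p\le \ell+1$, a partition $\pi$ of $[n]$ is $p$-independent if, whenever one chooses at most $p$ parts of $\pi$ and one element from each of them, the chosen elements form an independent set of $M$. A partition is independent if it is $(\ell+1)$-independent. For $3\le p\le\ell$, the matroid $M$ is $p$-independent if every $p$-independent partition of $[n]$ is independent. -}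

module Defs where

open import Algebra.Bundles using (CommutativeRing; Ring)
open import Algebra.Structures using (IsRing)
import Algebra.Properties.Ring as RingProperties
open import Data.Bool.Base using (true; false)
open import Data.Fin.Base using (Fin; zero; suc)
open import Data.Fin.Subset using (Subset; _∈_; _∉_; _⊆_; ⊥; ⁅_⁆; _∪_; ⋃; ∣_∣; Nonempty)
open import Data.Fin.Subset.Properties using (_∈?_)
open import Data.List.Base using (List; []; _∷_; allFin; filter; foldr; length; tabulate)
open import Data.Nat.Base using (ℕ; zero; suc; _≤_; _<_)
open import Data.Product.Base using (_×_; _,_; ∃)
import Data.Vec.Base as Vec
open import Function.Definitions using (Injective)
open import Level using (Level; _⊔_; 0ℓ)
open import Relation.Binary.Definitions using (Reflexive; Symmetric; Transitive)
open import Relation.Binary.PropositionalEquality.Core using (_≡_; _≢_)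
import Relation.Binary.PropositionalEquality.Core as ≡
import Relation.Binary.Reasoning.Setoid as SetoidReasoning
open import Relation.Nullary.Decidable.Core using (does)
open import Relation.Nullary.Negation.Core using (¬_)
open import Relation.Unary using (Pred; Decidable; _∩_; _≐_)

private
  variable
    c ℓ : Level
    n : ℕ

------------------------------------------------------------------------
-- Matroids

-- A matroid on the ground set Fin n.  Independence is asked to be
-- decidable, which is no restriction classically.

record Matroid (n : ℕ) : Set₁ where
  field
    Independent  : Pred (Subset n) 0ℓ
    independent? : Decidable Independent
    ⊥-independent : Independent ⊥
    hereditary   : ∀ {S T} → S ⊆ T → Independent T → Independent S
    exchange     : ∀ {S T} → Independent S → Independent T → ∣ S ∣ < ∣ T ∣ →
                   ∃ λ x → x ∈ T × x ∉ S × Independent (S ∪ ⁅ x ⁆)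

  Dependent : Pred (Subset n) 0ℓ
  Dependent S = ¬ Independent S

  Loop : Pred (Fin n) 0ℓ
  Loop i = Dependent ⁅ i ⁆

  -- i and j are distinct members of one parallel class
  Parallel : Fin n → Fin n → Set
  Parallel i j = i ≢ j × ¬ Loop i × ¬ Loop j × Dependent (⁅ i ⁆ ∪ ⁅ j ⁆)

  Simple : Set
  Simple = (∀ i → ¬ Loop i) × (∀ i j → ¬ Parallel i j)

  HasRank : ℕ → Set
  HasRank r = (∃ λ S → Independent S × ∣ S ∣ ≡ r) ×
              (∀ S → Independent S → ∣ S ∣ ≤ r)

record Partition (n : ℕ) : Set where
  field
    size     : ℕ
    part     : Fin size → Subset n
    nonempty : ∀ b → Nonempty (part b)
    disjoint : ∀ {a b x} → x ∈ part a → x ∈ part b → a ≡ b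
    covering : ∀ x → ∃ λ b → x ∈ part b

module _ (M : Matroid n) where
  open Matroid M

  -- B lists m distinct parts, and x picks one element from each of them.
  PIndependentPartition : ℕ → Pred (Partition n) 0ℓ
  PIndependentPartition p π =
    ∀ {m} → m ≤ p →
    (B : Fin m → Fin size) → Injective _≡_ _≡_ B →
    (x : Fin m → Fin n) → (∀ a → x a ∈ part (B a)) →
    Independent (⋃ (tabulate λ a → ⁅ x a ⁆))
    where open Partition π

  -- The argument r is the rank of the matroid.
  IndependentPartition : ℕ → Pred (Partition n) 0ℓ
  IndependentPartition r = PIndependentPartition (suc r)

  -- p-independence of a matroid of rank r, meant for 3 ≤ p ≤ r
  PIndependent : (r p : ℕ) → Set
  PIndependent r p = ∀ π → PIndependentPartition p π → IndependentPartition r π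

------------------------------------------------------------------------
-- The two-sided ideal generated by a set of elements

module _ (A : Ring c ℓ) where
  open Ring A

  data Ideal {g} (G : Pred Carrier g) : Pred Carrier (c ⊔ ℓ ⊔ g) where
    generator : ∀ {x} → G x → Ideal G x
    0-closed  : Ideal G 0#
    +-closed  : ∀ {x y} → Ideal G x → Ideal G y → Ideal G (x + y)
    *-closedˡ : ∀ a {x} → Ideal G x → Ideal G (a * x)
    *-closedʳ : ∀ {x} a → Ideal G x → Ideal G (x * a)
    ≈-closed  : ∀ {x y} → x ≈ y → Ideal G x → Ideal G y

private
  length-filter-∈-suc : ∀ {m n} b (S : Subset n) (f : Fin m → Fin n) →
    length (filter (_∈? (b Vec.∷ S)) (tabulate (λ i → suc (f i)))) ≡
    length (filter (_∈? S) (tabulate f))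
  length-filter-∈-suc {zero}  b S f = ≡.refl
  length-filter-∈-suc {suc m} b S f with does (f zero ∈? S)
  ... | true  = ≡.cong suc (length-filter-∈-suc b S (λ i → f (suc i)))
  ... | false = length-filter-∈-suc b S (λ i → f (suc i))

  length-filter-∈ : (S : Subset n) → length (filter (_∈? S) (allFin n)) ≡ ∣ S ∣
  length-filter-∈ Vec.[] = ≡.refl
  length-filter-∈ (true  Vec.∷ S) =
    ≡.cong suc (≡.trans (length-filter-∈-suc true S (λ i → i)) (length-filter-∈ S))
  length-filter-∈ (false Vec.∷ S) =
    ≡.trans (length-filter-∈-suc false S (λ i → i)) (length-filter-∈ S)

------------------------------------------------------------------------
-- The exterior algebra on the free R-module with basis indexed by Fin n

module Exterior (R : CommutativeRing c ℓ) (n : ℕ) where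
  private module R = CommutativeRing R

  infix  8 -_
  infixl 7 _*_
  infixl 6 _+_
  infix  4 _≈_

  -- An element is represented by an expression in scalars (κ) and basis
  -- vectors (e); the algebra is the setoid of expressions modulo _≈_.

  data Element : Set c where
    κ   : R.Carrier → Element
    e   : Fin n → Element
    _+_ : Element → Element → Element
    _*_ : Element → Element → Element
    -_  : Element → Element

  0# 1# : Element
  0# = κ R.0#
  1# = κ R.1#

  -- _≈_ is the least congruence giving an R-algebra in which e-square and
  -- e-anticomm hold.  By bilinearity these two say exactly that v * v ≈ 0#
  -- for every R-linear combination v of the basis vectors.

  data _≈_ : Element → Element → Set (c ⊔ ℓ) where
    refl  : Reflexive _≈_
    sym   : Symmetric _≈_
    trans : Transitive _≈_

    +-cong : ∀ {x x′ y y′} → x ≈ x′ → y ≈ y′ → x + y ≈ x′ + y′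
    *-cong : ∀ {x x′ y y′} → x ≈ x′ → y ≈ y′ → x * y ≈ x′ * y′
    neg-cong : ∀ {x x′} → x ≈ x′ → - x ≈ - x′

    +-assoc     : ∀ x y z → (x + y) + z ≈ x + (y + z)
    +-comm      : ∀ x y → x + y ≈ y + x
    +-identityˡ : ∀ x → 0# + x ≈ x
    neg-inverseˡ : ∀ x → - x + x ≈ 0#
    *-assoc     : ∀ x y z → (x * y) * z ≈ x * (y * z)
    *-identityˡ : ∀ x → 1# * x ≈ x
    *-identityʳ : ∀ x → x * 1# ≈ x
    distribˡ    : ∀ x y z → x * (y + z) ≈ x * y + x * z
    distribʳ    : ∀ x y z → (y + z) * x ≈ y * x + z * x

    κ-cong    : ∀ {r s} → r R.≈ s → κ r ≈ κ s
    κ-+       : ∀ r s → κ (r R.+ s) ≈ κ r + κ s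
    κ-*       : ∀ r s → κ (r R.* s) ≈ κ r * κ s
    κ-central : ∀ r x → κ r * x ≈ x * κ r

    e-square   : ∀ i → e i * e i ≈ 0#
    e-anticomm : ∀ i j → e i * e j ≈ - (e j * e i)

  isRing : IsRing _≈_ _+_ _*_ -_ 0# 1#
  isRing = record
    { +-isAbelianGroup = record
      { isGroup = record
        { isMonoid = record
          { isSemigroup = record
            { isMagma = record
              { isEquivalence = record { refl = refl ; sym = sym ; trans = trans }
              ; ∙-cong = +-cong
              }
            ; assoc = +-assoc
            }
          ; identity = +-identityˡ ,
                       λ x → trans (+-comm x 0#) (+-identityˡ x)
          }
        ; inverse = neg-inverseˡ ,
                    λ x → trans (+-comm x (- x)) (neg-inverseˡ x)
        ; ⁻¹-cong = neg-cong
        }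
      ; comm = +-comm
      }
    ; *-cong = *-cong
    ; *-assoc = *-assoc
    ; *-identity = *-identityˡ , *-identityʳ
    ; distrib = distribˡ , distribʳ
    }

  ring : Ring c (c ⊔ ℓ)
  ring = record { isRing = isRing }

  product : List (Fin n) → Element
  product = foldr (λ i x → e i * x) 1#

  -- e_S is the product of the e i for i ∈ S, in increasing order of i.
  e[_] : Subset n → Element
  e[ S ] = product (filter (_∈? S) (allFin n))

  -- The homogeneous component of degree p is the R-span of the e_S with
  -- S of size p.

  data Degree (p : ℕ) : Pred Element (c ⊔ ℓ) where
    basis    : ∀ S → ∣ S ∣ ≡ p → Degree p e[ S ]
    0-closed : Degree p 0#
    +-closed : ∀ {x y} → Degree p x → Degree p y → Degree p (x + y)
    κ-closed : ∀ r {x} → Degree p x → Degree p (κ r * x)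
    ≈-closed : ∀ {x y} → x ≈ y → Degree p x → Degree p y

  -- The grade involution, that is, the algebra endomorphism which acts on
  -- the component of degree p as multiplication by (-1)^p
  -- (see involute-degree).

  involute : Element → Element
  involute (κ r)   = κ r
  involute (e i)   = - e i
  involute (x + y) = involute x + involute y
  involute (x * y) = involute x * involute y
  involute (- x)   = - involute x

  -- The clause for _*_ is the graded Leibniz rule, with the sign
  -- (-1)^(deg x) supplied by the grade involution.

  ∂ : Element → Element
  ∂ (κ r)   = 0#
  ∂ (e i)   = 1#
  ∂ (x + y) = ∂ x + ∂ y
  ∂ (x * y) = ∂ x * y + involute x * ∂ y
  ∂ (- x)   = - ∂ x

  -- ∂ is defined on representatives; ∂-cong shows that it is well defined
  -- on the exterior algebra, and ∂-leibniz that it obeys the Leibniz rule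
  -- for homogeneous left factors.

  signed : ℕ → Element → Element
  signed zero    x = x
  signed (suc p) x = - signed p x

  private
    module E = Ring ring
    open RingProperties ring
      using (-0#≈0#; -‿distribˡ-*; -‿distribʳ-*; -‿involutive; -‿+-comm)
    open SetoidReasoning E.setoid

    neg-*-neg : ∀ x y → - x * - y ≈ x * y
    neg-*-neg x y = begin
      - x * - y     ≈⟨ -‿distribˡ-* x (- y) ⟨
      - (x * - y)   ≈⟨ neg-cong (-‿distribʳ-* x y) ⟨
      - - (x * y)   ≈⟨ -‿involutive (x * y) ⟩
      x * y         ∎

    ∂-e*e : ∀ i j → ∂ (e i * e j) ≈ e j + - e i
    ∂-e*e i j = +-cong (*-identityˡ (e j)) (*-identityʳ (- e i))

  involute-cong : ∀ {x y} → x ≈ y → involute x ≈ involute y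
  involute-cong refl = refl
  involute-cong (sym p) = sym (involute-cong p)
  involute-cong (trans p q) = trans (involute-cong p) (involute-cong q)
  involute-cong (+-cong p q) = +-cong (involute-cong p) (involute-cong q)
  involute-cong (*-cong p q) = *-cong (involute-cong p) (involute-cong q)
  involute-cong (neg-cong p) = neg-cong (involute-cong p)
  involute-cong (+-assoc x y z) = +-assoc _ _ _
  involute-cong (+-comm x y) = +-comm _ _
  involute-cong (+-identityˡ x) = +-identityˡ _
  involute-cong (neg-inverseˡ x) = neg-inverseˡ _
  involute-cong (*-assoc x y z) = *-assoc _ _ _
  involute-cong (*-identityˡ x) = *-identityˡ _
  involute-cong (*-identityʳ x) = *-identityʳ _
  involute-cong (distribˡ x y z) = distribˡ _ _ _
  involute-cong (distribʳ x y z) = distribʳ _ _ _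
  involute-cong (κ-cong p) = κ-cong p
  involute-cong (κ-+ r s) = κ-+ r s
  involute-cong (κ-* r s) = κ-* r s
  involute-cong (κ-central r x) = κ-central r _
  involute-cong (e-square i) = trans (neg-*-neg (e i) (e i)) (e-square i)
  involute-cong (e-anticomm i j) = begin
    - e i * - e j       ≈⟨ neg-*-neg (e i) (e j) ⟩
    e i * e j           ≈⟨ e-anticomm i j ⟩
    - (e j * e i)       ≈⟨ neg-cong (neg-*-neg (e j) (e i)) ⟨
    - (- e j * - e i)   ∎

  private
    interchange : ∀ w x y z → (w + x) + (y + z) ≈ (w + y) + (x + z)
    interchange w x y z = begin
      (w + x) + (y + z)   ≈⟨ +-assoc w x (y + z) ⟩
      w + (x + (y + z))   ≈⟨ E.+-congˡ (+-assoc x y z) ⟨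
      w + ((x + y) + z)   ≈⟨ E.+-congˡ (E.+-congʳ (+-comm x y)) ⟩
      w + ((y + x) + z)   ≈⟨ E.+-congˡ (+-assoc y x z) ⟩
      w + (y + (x + z))   ≈⟨ +-assoc w y (x + z) ⟨
      (w + y) + (x + z)   ∎

  ∂-cong : ∀ {x y} → x ≈ y → ∂ x ≈ ∂ y
  ∂-cong refl = refl
  ∂-cong (sym p) = sym (∂-cong p)
  ∂-cong (trans p q) = trans (∂-cong p) (∂-cong q)
  ∂-cong (+-cong p q) = +-cong (∂-cong p) (∂-cong q)
  ∂-cong (*-cong p q) =
    +-cong (*-cong (∂-cong p) q) (*-cong (involute-cong p) (∂-cong q))
  ∂-cong (neg-cong p) = neg-cong (∂-cong p)
  ∂-cong (+-assoc x y z) = +-assoc _ _ _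
  ∂-cong (+-comm x y) = +-comm _ _
  ∂-cong (+-identityˡ x) = +-identityˡ _
  ∂-cong (neg-inverseˡ x) = neg-inverseˡ _
  ∂-cong (*-assoc x y z) = begin
    (∂ x * y + x̂ * ∂ y) * z + x̂ * ŷ * ∂ z
      ≈⟨ +-cong (distribʳ z _ _) (*-assoc x̂ ŷ (∂ z)) ⟩
    (∂ x * y * z + x̂ * ∂ y * z) + x̂ * (ŷ * ∂ z)
      ≈⟨ E.+-congʳ (+-cong (*-assoc _ _ _) (*-assoc _ _ _)) ⟩
    (∂ x * (y * z) + x̂ * (∂ y * z)) + x̂ * (ŷ * ∂ z)
      ≈⟨ +-assoc _ _ _ ⟩
    ∂ x * (y * z) + (x̂ * (∂ y * z) + x̂ * (ŷ * ∂ z))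
      ≈⟨ E.+-congˡ (distribˡ x̂ _ _) ⟨
    ∂ x * (y * z) + x̂ * (∂ y * z + ŷ * ∂ z)
      ∎
    where
    x̂ = involute x
    ŷ = involute y
  ∂-cong (*-identityˡ x) = begin
    0# * x + 1# * ∂ x   ≈⟨ +-cong (E.zeroˡ x) (*-identityˡ (∂ x)) ⟩
    0# + ∂ x            ≈⟨ +-identityˡ (∂ x) ⟩
    ∂ x                 ∎
  ∂-cong (*-identityʳ x) = begin
    ∂ x * 1# + involute x * 0#   ≈⟨ +-cong (*-identityʳ (∂ x)) (E.zeroʳ _) ⟩
    ∂ x + 0#                     ≈⟨ E.+-identityʳ (∂ x) ⟩
    ∂ x                          ∎
  ∂-cong (distribˡ x y z) =
    trans (+-cong (distribˡ _ _ _) (distribˡ _ _ _)) (interchange _ _ _ _)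
  ∂-cong (distribʳ x y z) =
    trans (+-cong (distribʳ _ _ _) (distribʳ _ _ _)) (interchange _ _ _ _)
  ∂-cong (κ-cong p) = refl
  ∂-cong (κ-+ r s) = sym (+-identityˡ 0#)
  ∂-cong (κ-* r s) = begin
    0#                    ≈⟨ +-identityˡ 0# ⟨
    0# + 0#               ≈⟨ +-cong (E.zeroˡ (κ s)) (E.zeroʳ (κ r)) ⟨
    0# * κ s + κ r * 0#   ∎
  ∂-cong (κ-central r x) = begin
    0# * x + κ r * ∂ x           ≈⟨ +-comm _ _ ⟩
    κ r * ∂ x + 0# * x           ≈⟨ +-cong (κ-central r (∂ x)) (E.zeroˡ x) ⟩
    ∂ x * κ r + 0#               ≈⟨ E.+-congˡ (E.zeroʳ (involute x)) ⟨
    ∂ x * κ r + involute x * 0#  ∎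
  ∂-cong (e-square i) = trans (∂-e*e i i) (E.-‿inverseʳ (e i))
  ∂-cong (e-anticomm i j) = begin
    ∂ (e i * e j)       ≈⟨ ∂-e*e i j ⟩
    e j + - e i         ≈⟨ +-comm _ _ ⟩
    - e i + e j         ≈⟨ E.+-congˡ (-‿involutive (e j)) ⟨
    - e i + - - e j     ≈⟨ -‿+-comm (e i) (- e j) ⟩
    - (e i + - e j)     ≈⟨ neg-cong (∂-e*e j i) ⟨
    - ∂ (e j * e i)     ∎

  private
    signed-cong : ∀ p {x y} → x ≈ y → signed p x ≈ signed p y
    signed-cong zero    eq = eq
    signed-cong (suc p) eq = neg-cong (signed-cong p eq)

    signed-+ : ∀ p x y → signed p (x + y) ≈ signed p x + signed p y
    signed-+ zero    x y = refl
    signed-+ (suc p) x y = trans (neg-cong (signed-+ p x y)) (sym (-‿+-comm _ _))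

    signed-* : ∀ p x y → signed p (x * y) ≈ x * signed p y
    signed-* zero    x y = refl
    signed-* (suc p) x y = trans (neg-cong (signed-* p x y)) (-‿distribʳ-* x _)

    signed-0# : ∀ p → signed p 0# ≈ 0#
    signed-0# zero    = refl
    signed-0# (suc p) = trans (neg-cong (signed-0# p)) -0#≈0#

    involute-product : ∀ is → involute (product is) ≈ signed (length is) (product is)
    involute-product []       = refl
    involute-product (i ∷ is) = begin
      - e i * involute (product is)     ≈⟨ E.*-congˡ (involute-product is) ⟩
      - e i * signed k (product is)     ≈⟨ -‿distribˡ-* (e i) _ ⟨
      - (e i * signed k (product is))   ≈⟨ neg-cong (signed-* k (e i) _) ⟨
      - signed k (e i * product is)     ∎
      where k = length is

  involute-degree : ∀ {p x} → Degree p x → involute x ≈ signed p x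
  involute-degree (basis S ≡.refl) =
    E.trans (involute-product (filter (_∈? S) (allFin n)))
            (E.reflexive (≡.cong (λ k → signed k e[ S ]) (length-filter-∈ S)))
  involute-degree {p} 0-closed = sym (signed-0# p)
  involute-degree {p} (+-closed d d′) =
    trans (+-cong (involute-degree d) (involute-degree d′)) (sym (signed-+ p _ _))
  involute-degree {p} (κ-closed r d) =
    trans (*-cong refl (involute-degree d)) (sym (signed-* p (κ r) _))
  involute-degree {p} (≈-closed eq d) =
    trans (sym (involute-cong eq)) (trans (involute-degree d) (signed-cong p eq))

  ∂-leibniz : ∀ {p x} → Degree p x → ∀ y →
              ∂ (x * y) ≈ ∂ x * y + signed p (x * ∂ y)
  ∂-leibniz {p} {x} d y = E.+-congˡ (begin
    involute x * ∂ y     ≈⟨ *-cong (involute-degree d) refl ⟩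
    signed p x * ∂ y     ≈⟨ signed-*ʳ p ⟩
    signed p (x * ∂ y)   ∎)
    where
    signed-*ʳ : ∀ q → signed q x * ∂ y ≈ signed q (x * ∂ y)
    signed-*ʳ zero    = refl
    signed-*ʳ (suc q) = trans (sym (-‿distribˡ-* _ _)) (neg-cong (signed-*ʳ q))

------------------------------------------------------------------------
-- The Orlik–Solomon ideal

module _ (R : CommutativeRing c ℓ) {n : ℕ} (M : Matroid n) where
  open Exterior R n
  open Matroid M

  OrlikSolomonIdeal : Pred Element (c ⊔ ℓ)
  OrlikSolomonIdeal =
    Ideal ring (λ x → ∃ λ S → Dependent S × x ≈ ∂ e[ S ])

  -- The Orlik–Solomon algebra is quadratic.
  Quadratic : Set (c ⊔ ℓ)
  Quadratic = OrlikSolomonIdeal ≐ Ideal ring (OrlikSolomonIdeal ∩ Degree 2)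

{-# OPTIONS --safe #-}
module Submission where

-- Send e_i to the generator indexed by the part of i, an algebra homomorphism
-- onto the exterior algebra Λ on the parts which commutes with ∂.  By simplicity
-- and 3-independence, ∂ e_S is sent into degree ≥ 3 for every dependent S: if
-- |S| = 3 then two elements of S share a part, so e_S and hence ∂ e_S go to 0.
-- So the degree 2 component of I(M) goes to 0, and if A(M) is quadratic then so
-- does I(M).  But if S is a transversal of some parts, then e_i ∂ e_S = e_S for
-- i ∈ S has nonzero image, so S must be independent.

open import Defs
open import Algebra.Bundles using (CommutativeMonoid; CommutativeRing; Ring)
open import Algebra.Module.Bundles using (Module)
import Algebra.Module.Construct.DirectProduct as DirectProduct
import Algebra.Module.Construct.TensorUnit as TensorUnit
import Algebra.Properties.AbelianGroup as AbelianGroupProperties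
import Algebra.Properties.CommutativeSemigroup as CommutativeSemigroupProperties
import Algebra.Properties.Ring as RingProperties
open import Data.Bool.Base using (true; false)
open import Data.Empty using (⊥-elim)
open import Data.Fin.Base using (Fin; zero; suc)
open import Data.Fin.Properties using (_≟_)
open import Data.Fin.Subset using (Subset; ⁅_⁆; _∪_; ⋃; ∣_∣) renaming (_∈_ to _∈ˢ_)
open import Data.Fin.Subset.Properties
  using (_∈?_; x∈⁅x⁆; x∈⁅y⁆⇒x≡y; x∈p∪q⁺; x∈p∪q⁻; ∉⊥)
open import Data.List.Base using (List; []; _∷_; allFin; filter; length; lookup; map; tabulate)
open import Data.List.Membership.Propositional using (_∈_)
open import Data.List.Membership.Propositional.Properties
  using (∈-allFin; ∈-filter⁺; ∈-filter⁻)
open import Data.List.Properties using (map-tabulate)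
open import Data.List.Relation.Unary.All as All using (All; []; _∷_)
import Data.List.Relation.Unary.All.Properties as All
open import Data.List.Relation.Unary.AllPairs using ([]; _∷_)
open import Data.List.Relation.Unary.Any using (here; there; index)
open import Data.List.Relation.Unary.Any.Properties using (lookup-index; ¬Any[])
open import Data.List.Relation.Unary.Unique.Propositional using (Unique)
import Data.List.Relation.Unary.Unique.Propositional.Properties as Unique
open import Data.Nat.Base as ℕ using (ℕ; zero; suc; _≤_; _<_; z≤n; s≤s)
open import Data.Nat.Properties
  using (≤-refl; ≤-trans; ≤-reflexive; n≤1+n; +-monoˡ-≤; 1+n≰n)
open import Data.Product.Base using (_×_; _,_; ∃; proj₁; proj₂)
open import Data.Sum.Base using (_⊎_; inj₁; inj₂)
import Data.Vec.Base as Vec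
open import Function.Base using (_∘_; id)
open import Level using (Level)
open import Relation.Binary.PropositionalEquality.Core as ≡ using (_≡_; _≢_)
import Relation.Binary.Reasoning.Setoid as SetoidReasoning
open import Relation.Nullary.Decidable.Core using (yes; no; does; decidable-stable)
open import Relation.Nullary.Negation.Core using (¬_)
open import Relation.Unary using (Pred; _⊆_)

private
  variable
    c ℓ : Level

-- Enumeration of the elements of a finite subset.

elements : ∀ {n} → Subset n → List (Fin n)
elements {n} S = filter (_∈? S) (allFin n)

elements-unique : ∀ {n} (S : Subset n) → Unique (elements S)
elements-unique {n} S = Unique.filter⁺ (_∈? S) (Unique.allFin⁺ n)

∈-elements⁺ : ∀ {n} (S : Subset n) {x} → x ∈ˢ S → x ∈ elements S
∈-elements⁺ S x∈S = ∈-filter⁺ (_∈? S) (∈-allFin _) x∈S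

∈-elements⁻ : ∀ {n} (S : Subset n) {x} → x ∈ elements S → x ∈ˢ S
∈-elements⁻ {n} S x∈ = proj₂ (∈-filter⁻ (_∈? S) {xs = allFin n} x∈)

length-elements-tail : ∀ {n} b (S : Subset n) →
  length (filter (_∈? (b Vec.∷ S)) (tabulate suc)) ≡ length (elements S)
length-elements-tail b S = ≡.trans
  -- The induction in `shift` runs over arbitrary lists, so `tabulate suc` is first turned into
  -- `map suc (allFin _)`.
  (≡.cong (length ∘ filter (_∈? (b Vec.∷ S))) (≡.sym (map-tabulate id suc))) (shift (allFin _))
  where
  shift : ∀ xs →
    length (filter (_∈? (b Vec.∷ S)) (map suc xs)) ≡ length (filter (_∈? S) xs)
  shift []       = ≡.refl
  shift (x ∷ xs) with does (x ∈? S)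
  ... | true  = ≡.cong suc (shift xs)
  ... | false = shift xs

length-elements : ∀ {n} (S : Subset n) → length (elements S) ≡ ∣ S ∣
length-elements Vec.[]          = ≡.refl
length-elements (true  Vec.∷ S) =
  ≡.cong suc (≡.trans (length-elements-tail true S) (length-elements S))
length-elements (false Vec.∷ S) = ≡.trans (length-elements-tail false S) (length-elements S)

∈-⋃-singletons⁺ : ∀ {m n} (x : Fin m → Fin n) a → x a ∈ˢ ⋃ (tabulate λ b → ⁅ x b ⁆)
∈-⋃-singletons⁺ x zero    = x∈p∪q⁺ (inj₁ (x∈⁅x⁆ (x zero)))
∈-⋃-singletons⁺ x (suc a) = x∈p∪q⁺ (inj₂ (∈-⋃-singletons⁺ (x ∘ suc) a))

∈-⋃-singletons⁻ : ∀ {m n} (x : Fin m → Fin n) {y} →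
  y ∈ˢ ⋃ (tabulate λ b → ⁅ x b ⁆) → ∃ λ a → y ≡ x a
∈-⋃-singletons⁻ {zero}  x y∈ = ⊥-elim (∉⊥ y∈)
∈-⋃-singletons⁻ {suc m} x y∈ with x∈p∪q⁻ ⁅ x zero ⁆ _ y∈
... | inj₁ y∈₀ = zero , x∈⁅y⁆⇒x≡y (x zero) y∈₀
... | inj₂ y∈₊ with ∈-⋃-singletons⁻ (x ∘ suc) y∈₊
...   | a , y≡xa = suc a , y≡xa

-- Injectivity is asked only on members of `xs`: the labelling by parts is injective on a
-- transversal, but in general not on the ground set.
unique-map : ∀ {a b} {A : Set a} {B : Set b} (f : A → B) {xs} →
  (∀ {x y} → x ∈ xs → y ∈ xs → f x ≡ f y → x ≡ y) → Unique xs → Unique (map f xs)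
unique-map f inj []         = []
unique-map f inj (x∉ ∷ xs!) =
  All.map⁺ (All.tabulate λ y∈ fx≡fy → All.lookup x∉ y∈ (inj (here ≡.refl) (there y∈) fx≡fy))
  ∷ unique-map f (λ x∈ y∈ → inj (there x∈) (there y∈)) xs!

-- Linear endomorphisms of a module.

module _ {R : CommutativeRing c ℓ} where

  module _ (M : Module R c ℓ) where
    open Module M
    open AbelianGroupProperties +ᴹ-abelianGroup using (inverseˡ-unique)

    *ₗ-neg : ∀ r v → r *ₗ (-ᴹ v) ≈ᴹ -ᴹ (r *ₗ v)
    *ₗ-neg r v = inverseˡ-unique _ _ (≈ᴹ-trans (≈ᴹ-sym (*ₗ-distribˡ r (-ᴹ v) v))
      (≈ᴹ-trans (*ₗ-congˡ (-ᴹ‿inverseˡ v)) (*ₗ-zeroʳ r)))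

  record Linear (M : Module R c ℓ) (f : Module.Carrierᴹ M → Module.Carrierᴹ M) : Set (c Level.⊔ ℓ) where
    open Module M
    open AbelianGroupProperties +ᴹ-abelianGroup using (inverseˡ-unique)
    field
      cong : ∀ {v w} → v ≈ᴹ w → f v ≈ᴹ f w
      +-homo : ∀ v w → f (v +ᴹ w) ≈ᴹ f v +ᴹ f w
      *ₗ-homo : ∀ r v → f (r *ₗ v) ≈ᴹ r *ₗ f v

    0-homo : f 0ᴹ ≈ᴹ 0ᴹ
    0-homo = ≈ᴹ-trans (cong (≈ᴹ-sym (*ₗ-zeroˡ 0ᴹ))) (≈ᴹ-trans (*ₗ-homo _ _) (*ₗ-zeroˡ _))

    -‿homo : ∀ v → f (-ᴹ v) ≈ᴹ -ᴹ f v
    -‿homo v = inverseˡ-unique _ _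
      (≈ᴹ-trans (≈ᴹ-sym (+-homo (-ᴹ v) v)) (≈ᴹ-trans (cong (-ᴹ‿inverseˡ v)) 0-homo))

  module _ {M : Module R c ℓ} where
    open Module M
    open AbelianGroupProperties +ᴹ-abelianGroup using (⁻¹-∙-comm)
    open CommutativeSemigroupProperties
      (CommutativeMonoid.commutativeSemigroup +ᴹ-commutativeMonoid) using (interchange)

    ∘-linear : ∀ {f g} → Linear M f → Linear M g → Linear M (f ∘ g)
    ∘-linear F G = record
      { cong    = F.cong ∘ G.cong
      ; +-homo  = λ v w → ≈ᴹ-trans (F.cong (G.+-homo v w)) (F.+-homo _ _)
      ; *ₗ-homo = λ r v → ≈ᴹ-trans (F.cong (G.*ₗ-homo r v)) (F.*ₗ-homo r _)
      }
      where
      module F = Linear F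
      module G = Linear G

    +-linear : ∀ {f g} → Linear M f → Linear M g → Linear M (λ v → f v +ᴹ g v)
    +-linear F G = record
      { cong    = λ p → +ᴹ-cong (F.cong p) (G.cong p)
      ; +-homo  = λ v w → ≈ᴹ-trans (+ᴹ-cong (F.+-homo v w) (G.+-homo v w)) (interchange _ _ _ _)
      ; *ₗ-homo = λ r v → ≈ᴹ-trans (+ᴹ-cong (F.*ₗ-homo r v) (G.*ₗ-homo r v))
                                   (≈ᴹ-sym (*ₗ-distribˡ r _ _))
      }
      where
      module F = Linear F
      module G = Linear G

    neg-linear : Linear M -ᴹ_
    neg-linear = record
      { cong    = -ᴹ‿cong
      ; +-homo  = λ v w → ≈ᴹ-sym (⁻¹-∙-comm v w)
      ; *ₗ-homo = λ r v → ≈ᴹ-sym (*ₗ-neg M r v)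
      }

    *ₗ-linear : ∀ r → Linear M (r *ₗ_)
    *ₗ-linear r = record
      { cong    = *ₗ-congˡ
      ; +-homo  = *ₗ-distribˡ r
      ; *ₗ-homo = λ s v → *ₗ-comm r s v
      }

-- Vectors of the exterior algebra and their degrees.

-- The underlying module of the exterior algebra on k generators: (a , b)
-- stands for a + f b, where f is the first generator and a and b involve
-- only the others.

module ExteriorModule (R : CommutativeRing c ℓ) where
  private module R = CommutativeRing R

  Λ : ℕ → Module R c ℓ
  Λ zero    = TensorUnit.⟨module⟩
  Λ (suc k) = DirectProduct.⟨module⟩ (Λ k) (Λ k)

  module Λ (k : ℕ) where
    open Module (Λ k) public
    open AbelianGroupProperties +ᴹ-abelianGroup public
      using (ε⁻¹≈ε; ⁻¹-involutive; ⁻¹-injective)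

  Vector : ℕ → Set c
  Vector k = Λ.Carrierᴹ k

  -- Left multiplication by a generator. A generator other than the first generator `f` anticommutes
  -- with it, so it sends `a + f b` to its product with `a`, minus `f` times its product with `b`.
  wedge : ∀ {k} → Fin k → Vector k → Vector k
  wedge {suc k} zero    (a , b) = Λ.0ᴹ k , a
  wedge {suc k} (suc i) (a , b) = wedge i a , Λ.-ᴹ_ k (wedge i b)

  wedge-linear : ∀ {k} (i : Fin k) → Linear (Λ k) (wedge i)
  wedge-linear {suc k} zero = record
    { cong    = λ (p , q) → Λ.≈ᴹ-refl k , p
    ; +-homo  = λ _ _ → Λ.≈ᴹ-sym k (Λ.+ᴹ-identityˡ k _) , Λ.≈ᴹ-refl k
    ; *ₗ-homo = λ r _ → Λ.≈ᴹ-sym k (Λ.*ₗ-zeroʳ k r) , Λ.≈ᴹ-refl k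
    }
  wedge-linear {suc k} (suc i) = record
    { cong    = λ (p , q) → F.cong p , G.cong q
    ; +-homo  = λ (a , b) (a′ , b′) → F.+-homo a a′ , G.+-homo b b′
    ; *ₗ-homo = λ r (a , b) → F.*ₗ-homo r a , G.*ₗ-homo r b
    }
    where
    module F = Linear (wedge-linear i)
    module G = Linear (∘-linear (neg-linear {M = Λ k}) (wedge-linear i))

  -- Two successive later generators act on the second coordinate in this shape; the two signs
  -- cancel by linearity.
  neg-wedge-neg : ∀ {k} (i : Fin k) v →
    Λ._≈ᴹ_ k (Λ.-ᴹ_ k (wedge i (Λ.-ᴹ_ k v))) (wedge i v)
  neg-wedge-neg {k} i v = ≈ᴹ-trans (-ᴹ‿cong (Linear.-‿homo (wedge-linear i) v)) (⁻¹-involutive _)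
    where open Λ k

  wedge-square : ∀ {k} (i : Fin k) v → Λ._≈ᴹ_ k (wedge i (wedge i v)) (Λ.0ᴹ k)
  wedge-square {suc k} zero    (a , b) = Λ.≈ᴹ-refl k , Λ.≈ᴹ-refl k
  wedge-square {suc k} (suc i) (a , b) =
    wedge-square i a , Λ.≈ᴹ-trans k (neg-wedge-neg i _) (wedge-square i b)

  wedge-anticomm : ∀ {k} (i j : Fin k) v →
    Λ._≈ᴹ_ k (wedge i (wedge j v)) (Λ.-ᴹ_ k (wedge j (wedge i v)))
  wedge-anticomm {suc k} zero zero (a , b) = ≈ᴹ-sym ε⁻¹≈ε , ≈ᴹ-sym ε⁻¹≈ε
    where open Λ k
  wedge-anticomm {suc k} zero (suc j) (a , b) =
    ≈ᴹ-sym (≈ᴹ-trans (-ᴹ‿cong (Linear.0-homo (wedge-linear j))) ε⁻¹≈ε) , ≈ᴹ-sym (⁻¹-involutive _)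
    where open Λ k
  wedge-anticomm {suc k} (suc i) zero (a , b) =
    ≈ᴹ-trans (Linear.0-homo (wedge-linear i)) (≈ᴹ-sym ε⁻¹≈ε) , ≈ᴹ-refl
    where open Λ k
  wedge-anticomm {suc k} (suc i) (suc j) (a , b) = wedge-anticomm i j a ,
    ≈ᴹ-trans (neg-wedge-neg i _) (≈ᴹ-trans (wedge-anticomm i j b)
      (-ᴹ‿cong (≈ᴹ-sym (neg-wedge-neg j _))))
    where open Λ k

  -- The unit of the exterior algebra; acting on it gives the image of an element of `E`.
  vacuum : ∀ k → Vector k
  vacuum zero    = R.1#
  vacuum (suc k) = vacuum k , Λ.0ᴹ k

  vacuum≉0 : ¬ (R.1# R.≈ R.0#) → ∀ k → ¬ Λ._≈ᴹ_ k (vacuum k) (Λ.0ᴹ k)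
  vacuum≉0 1≉0 zero    eq       = 1≉0 eq
  vacuum≉0 1≉0 (suc k) (eq , _) = vacuum≉0 1≉0 k eq

  -- Only monomials without the generator i occur.
  Free : ∀ {k} → Fin k → Vector k → Set ℓ
  Free {suc k} zero    (a , b) = Λ._≈ᴹ_ k b (Λ.0ᴹ k)
  Free {suc k} (suc i) (a , b) = Free i a × Free i b

  free-resp : ∀ {k} (i : Fin k) {v w} → Λ._≈ᴹ_ k v w → Free i v → Free i w
  free-resp {suc k} zero    (p , q) v∌i         = Λ.≈ᴹ-trans k (Λ.≈ᴹ-sym k q) v∌i
  free-resp {suc k} (suc i) (p , q) (a∌i , b∌i) = free-resp i p a∌i , free-resp i q b∌i

  free-0 : ∀ {k} (i : Fin k) → Free i (Λ.0ᴹ k)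
  free-0 {suc k} zero    = Λ.≈ᴹ-refl k
  free-0 {suc k} (suc i) = free-0 i , free-0 i

  free-neg : ∀ {k} (i : Fin k) {v} → Free i v → Free i (Λ.-ᴹ_ k v)
  free-neg {suc k} zero    v∌i         = Λ.≈ᴹ-trans k (Λ.-ᴹ‿cong k v∌i) (Λ.ε⁻¹≈ε k)
  free-neg {suc k} (suc i) (a∌i , b∌i) = free-neg i a∌i , free-neg i b∌i

  free-vacuum : ∀ {k} (i : Fin k) → Free i (vacuum k)
  free-vacuum {suc k} zero    = Λ.≈ᴹ-refl k
  free-vacuum {suc k} (suc i) = free-vacuum i , free-0 i

  free-wedge : ∀ {k} (i j : Fin k) {v} → i ≢ j → Free i v → Free i (wedge j v)
  free-wedge zero zero i≢j _ = ⊥-elim (i≢j ≡.refl)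
  free-wedge {suc k} zero (suc j) i≢j v∌i =
    ≈ᴹ-trans (-ᴹ‿cong (≈ᴹ-trans (cong v∌i) 0-homo)) ε⁻¹≈ε
    where
    open Λ k
    open Linear (wedge-linear j)
  free-wedge (suc i) zero    i≢j (a∌i , b∌i) = free-0 i , a∌i
  free-wedge (suc i) (suc j) i≢j (a∌i , b∌i) =
    free-wedge i j (i≢j ∘ ≡.cong suc) a∌i , free-neg i (free-wedge i j (i≢j ∘ ≡.cong suc) b∌i)

  -- Multiplication by a generator sends the monomials without it to distinct monomials, up to sign.
  -- At `zero` it moves `a` to the second coordinate, while freeness already says that `b` vanishes.
  wedge-injective-free : ∀ {k} (i : Fin k) {v} → Free i v →
    Λ._≈ᴹ_ k (wedge i v) (Λ.0ᴹ k) → Λ._≈ᴹ_ k v (Λ.0ᴹ k)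
  wedge-injective-free zero v∌i (_ , a≈0) = a≈0 , v∌i
  wedge-injective-free {suc k} (suc i) (a∌i , b∌i) (wa≈0 , -wb≈0) =
    wedge-injective-free i a∌i wa≈0 ,
    wedge-injective-free i b∌i (⁻¹-injective (≈ᴹ-trans -wb≈0 (≈ᴹ-sym ε⁻¹≈ε)))
    where open Λ k

  -- The components of v in the degrees outside D vanish.
  Supp : ∀ k → (ℕ → Set) → Vector k → Set ℓ
  Supp zero    D v       = (v R.≈ R.0#) ⊎ D 0
  Supp (suc k) D (a , b) = Supp k D a × Supp k (D ∘ suc) b

  supp-resp : ∀ {k D} {v w : Vector k} → Λ._≈ᴹ_ k v w → Supp k D v → Supp k D w
  supp-resp {zero}  p       (inj₁ v≈0) = inj₁ (R.trans (R.sym p) v≈0)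
  supp-resp {zero}  p       (inj₂ D0)  = inj₂ D0
  supp-resp {suc k} (p , q) (s , t)    = supp-resp p s , supp-resp q t

  supp-0 : ∀ {k D} → Supp k D (Λ.0ᴹ k)
  supp-0 {zero}  = inj₁ R.refl
  supp-0 {suc k} = supp-0 {k} , supp-0 {k}

  supp-+ : ∀ {k D} {v w : Vector k} → Supp k D v → Supp k D w → Supp k D (Λ._+ᴹ_ k v w)
  supp-+ {zero}  (inj₂ D0) _         = inj₂ D0
  supp-+ {zero}  (inj₁ _)  (inj₂ D0) = inj₂ D0
  supp-+ {zero}  (inj₁ p)  (inj₁ q)  = inj₁ (R.trans (R.+-cong p q) (R.+-identityˡ _))
  supp-+ {suc k} (s , t)   (s′ , t′) = supp-+ s s′ , supp-+ t t′

  supp-*ₗ : ∀ {k D} r {v : Vector k} → Supp k D v → Supp k D (Λ._*ₗ_ k r v)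
  supp-*ₗ {zero}  r (inj₂ D0) = inj₂ D0
  supp-*ₗ {zero}  r (inj₁ p)  = inj₁ (R.trans (R.*-congˡ p) (R.zeroʳ r))
  supp-*ₗ {suc k} r (s , t)   = supp-*ₗ r s , supp-*ₗ r t

  supp-neg : ∀ {k D} {v : Vector k} → Supp k D v → Supp k D (Λ.-ᴹ_ k v)
  supp-neg {zero}  (inj₂ D0) = inj₂ D0
  supp-neg {zero}  (inj₁ p)  = inj₁ (R.trans (R.-‿cong p) (Λ.ε⁻¹≈ε 0))
  supp-neg {suc k} (s , t)   = supp-neg s , supp-neg t

  supp-mono : ∀ {k} {D D′ : ℕ → Set} {v : Vector k} →
    (∀ {p} → D p → D′ p) → Supp k D v → Supp k D′ v
  supp-mono {zero}  D⊆D′ (inj₁ p)  = inj₁ p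
  supp-mono {zero}  D⊆D′ (inj₂ D0) = inj₂ (D⊆D′ D0)
  supp-mono {suc k} D⊆D′ (s , t)   = supp-mono D⊆D′ s , supp-mono D⊆D′ t

  supp-disjoint : ∀ {k} {D D′ : ℕ → Set} {v : Vector k} →
    (∀ {p} → D p → ¬ D′ p) → Supp k D v → Supp k D′ v → Λ._≈ᴹ_ k v (Λ.0ᴹ k)
  supp-disjoint {zero}  D∩D′ (inj₁ p) _         = p
  supp-disjoint {zero}  D∩D′ (inj₂ _) (inj₁ p)  = p
  supp-disjoint {zero}  D∩D′ (inj₂ x) (inj₂ y)  = ⊥-elim (D∩D′ x y)
  supp-disjoint {suc k} D∩D′ (s , t)  (s′ , t′) =
    supp-disjoint D∩D′ s s′ , supp-disjoint D∩D′ t t′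

  -- A generator raises degrees by one. Pulling `D` back along `suc` matches the second component of
  -- `Supp`, so no arithmetic arises.
  supp-wedge : ∀ {k D} (i : Fin k) {v : Vector k} → Supp k (D ∘ suc) v → Supp k D (wedge i v)
  supp-wedge {suc k} zero    (s , t) = supp-0 {k} , s
  supp-wedge {suc k} (suc i) (s , t) = supp-wedge i s , supp-neg (supp-wedge i t)

  -- Every vector is a sum of homogeneous ones: split `(a , b)` as `(a , 0ᴹ)` plus `(0ᴹ , b)` and
  -- recurse on each. The second summand carries the first generator, hence `suc p` in its degree.
  homogeneous-induction : ∀ {k p} (P : Pred (Vector k) p) →
    (∀ {v w} → Λ._≈ᴹ_ k v w → P v → P w) →
    (∀ {v w} → P v → P w → P (Λ._+ᴹ_ k v w)) →
    (∀ p {v} → Supp k (p ≡_) v → P v) → ∀ v → P v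
  homogeneous-induction {zero} P resp plus hom v = hom 0 (inj₂ ≡.refl)
  homogeneous-induction {suc k} P resp plus hom (a , b) =
    resp (+ᴹ-identityʳ a , +ᴹ-identityˡ b) (plus
      (homogeneous-induction (λ a → P (a , 0ᴹ)) (λ p → resp (p , ≈ᴹ-refl))
        (λ x y → resp (≈ᴹ-refl , +ᴹ-identityˡ _) (plus x y))
        (λ p s → hom p (s , supp-0 {k})) a)
      (homogeneous-induction (λ b → P (0ᴹ , b)) (λ p → resp (≈ᴹ-refl , p))
        (λ x y → resp (+ᴹ-identityˡ _ , ≈ᴹ-refl) (plus x y))
        (λ p s → hom (suc p) (supp-0 {k} , supp-mono (≡.cong suc) s)) b))
    where open Λ k

-- Elements of the exterior algebra as operators.

-- The action of the exterior algebra on Λ k through the algebra homomorphism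
-- which sends e i to the generator f i.

module Action (R : CommutativeRing c ℓ) {n k : ℕ} (f : Fin n → Fin k) where
  open ExteriorModule R
  open Exterior R n
  open Module (Λ k)
  open AbelianGroupProperties +ᴹ-abelianGroup using (ε⁻¹≈ε)

  -- Composition of operators replaces a product on `Λ k`, so that associativity and right
  -- distributivity hold by definition.
  act : Element → Vector k → Vector k
  act (κ r)   v = r *ₗ v
  act (e i)   v = wedge (f i) v
  act (x + y) v = act x v +ᴹ act y v
  act (x * y) v = act x (act y v)
  act (- x)   v = -ᴹ act x v

  act-linear : ∀ x → Linear (Λ k) (act x)
  act-linear (κ r)   = *ₗ-linear r
  act-linear (e i)   = wedge-linear (f i)
  act-linear (x + y) = +-linear (act-linear x) (act-linear y)
  act-linear (x * y) = ∘-linear (act-linear x) (act-linear y)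
  act-linear (- x)   = ∘-linear (neg-linear {M = Λ k}) (act-linear x)

  act-cong : ∀ {x y} → x ≈ y → ∀ v → act x v ≈ᴹ act y v
  act-cong refl v = ≈ᴹ-refl
  act-cong (sym p) v = ≈ᴹ-sym (act-cong p v)
  act-cong (trans p q) v = ≈ᴹ-trans (act-cong p v) (act-cong q v)
  act-cong (+-cong p q) v = +ᴹ-cong (act-cong p v) (act-cong q v)
  act-cong (*-cong {x} p q) v =
    ≈ᴹ-trans (Linear.cong (act-linear x) (act-cong q v)) (act-cong p _)
  act-cong (neg-cong p) v = -ᴹ‿cong (act-cong p v)
  act-cong (+-assoc x y z) v = +ᴹ-assoc _ _ _
  act-cong (+-comm x y) v = +ᴹ-comm _ _
  act-cong (+-identityˡ x) v = ≈ᴹ-trans (+ᴹ-congʳ (*ₗ-zeroˡ v)) (+ᴹ-identityˡ _)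
  act-cong (neg-inverseˡ x) v = ≈ᴹ-trans (-ᴹ‿inverseˡ _) (≈ᴹ-sym (*ₗ-zeroˡ v))
  act-cong (*-assoc x y z) v = ≈ᴹ-refl
  act-cong (*-identityˡ x) v = *ₗ-identityˡ _
  act-cong (*-identityʳ x) v = Linear.cong (act-linear x) (*ₗ-identityˡ v)
  act-cong (distribˡ x y z) v = Linear.+-homo (act-linear x) _ _
  act-cong (distribʳ x y z) v = ≈ᴹ-refl
  act-cong (κ-cong p) v = *ₗ-congʳ p
  act-cong (κ-+ r s) v = *ₗ-distribʳ v r s
  act-cong (κ-* r s) v = *ₗ-assoc r s v
  act-cong (κ-central r x) v = ≈ᴹ-sym (Linear.*ₗ-homo (act-linear x) r v)
  act-cong (e-square i) v = ≈ᴹ-trans (wedge-square (f i) v) (≈ᴹ-sym (*ₗ-zeroˡ v))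
  act-cong (e-anticomm i j) v = wedge-anticomm (f i) (f j) v

  -- The kernel of the homomorphism. Quantifying over all vectors, and not only testing the unit,
  -- makes closure under right multiplication immediate.
  Annihilates : Element → Set _
  Annihilates x = ∀ v → act x v ≈ᴹ 0ᴹ

  annihilates-ideal : ∀ {g} {G : Pred Element g} →
    G ⊆ Annihilates → Ideal ring G ⊆ Annihilates
  annihilates-ideal G⊆A (generator g) = G⊆A g
  annihilates-ideal G⊆A 0-closed v = *ₗ-zeroˡ v
  annihilates-ideal G⊆A (+-closed p q) v =
    ≈ᴹ-trans (+ᴹ-cong (annihilates-ideal G⊆A p v) (annihilates-ideal G⊆A q v)) (+ᴹ-identityˡ 0ᴹ)
  annihilates-ideal G⊆A (*-closedˡ a p) v =
    ≈ᴹ-trans (cong (annihilates-ideal G⊆A p v)) 0-homo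
    where open Linear (act-linear a)
  annihilates-ideal G⊆A (*-closedʳ a p) v = annihilates-ideal G⊆A p _
  annihilates-ideal G⊆A (≈-closed x≈y p) v =
    ≈ᴹ-trans (≈ᴹ-sym (act-cong x≈y v)) (annihilates-ideal G⊆A p v)

  -- With _∼_ = _≡_ this says that x acts as an operator of degree q, and with
  -- _∼_ = _≤_ that it raises degrees by at least q.
  record Shifts (_∼_ : ℕ → ℕ → Set) (q : ℕ) (x : Element) : Set (c Level.⊔ ℓ) where
    constructor shifts
    field supp-act : ∀ p v → Supp k (p ∼_) v → Supp k ((q ℕ.+ p) ∼_) (act x v)

  open Shifts

  module _ {_∼_ : ℕ → ℕ → Set} where

    shifts-≈ : ∀ q {x y} → x ≈ y → Shifts _∼_ q x → Shifts _∼_ q y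
    shifts-≈ q x≈y s = shifts λ p v σ → supp-resp (act-cong x≈y v) (supp-act s p v σ)

    shifts-0 : ∀ q → Shifts _∼_ q 0#
    shifts-0 q = shifts λ p v σ → supp-resp (≈ᴹ-sym (*ₗ-zeroˡ v)) (supp-0 {k})

    shifts-κ : ∀ q r {x} → Shifts _∼_ q x → Shifts _∼_ q (κ r * x)
    shifts-κ q r s = shifts λ p v σ → supp-*ₗ r (supp-act s p v σ)

    shifts-+ : ∀ q {x y} → Shifts _∼_ q x → Shifts _∼_ q y → Shifts _∼_ q (x + y)
    shifts-+ q s t = shifts λ p v σ → supp-+ (supp-act s p v σ) (supp-act t p v σ)

    module _ (∼-suc : ∀ {p q} → p ∼ q → suc p ∼ suc q) where

      shifts-e : ∀ q i {x} → Shifts _∼_ q x → Shifts _∼_ (suc q) (e i * x)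
      shifts-e q i s = shifts λ p v σ → supp-wedge (f i) (supp-mono ∼-suc (supp-act s p v σ))

      shifts-product : ∀ is → Shifts _∼_ (length is) (product is)
      shifts-product []       = shifts λ p v σ → supp-resp (≈ᴹ-sym (*ₗ-identityˡ v)) σ
      shifts-product (i ∷ is) = shifts-e (length is) i (shifts-product is)

      shifts-degree : ∀ {q x} → Degree q x → Shifts _∼_ q x
      shifts-degree (basis S ∣S∣≡q) = ≡.subst (λ q → Shifts _∼_ q e[ S ])
        (≡.trans (length-elements S) ∣S∣≡q) (shifts-product (elements S))
      shifts-degree {q} 0-closed         = shifts-0 q
      shifts-degree {q} (+-closed d d′)  = shifts-+ q (shifts-degree d) (shifts-degree d′)
      shifts-degree {q} (κ-closed r d)   = shifts-κ q r (shifts-degree d)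
      shifts-degree {q} (≈-closed x≈y d) = shifts-≈ q x≈y (shifts-degree d)

  annihilates⇒shifts : ∀ {_∼_} q {x} → Annihilates x → Shifts _∼_ q x
  annihilates⇒shifts q xv≈0 = shifts λ p v σ → supp-resp (≈ᴹ-sym (xv≈0 v)) (supp-0 {k})

  shifts-weaken : ∀ {q q′ x} → q ≤ q′ → Shifts _≤_ q′ x → Shifts _≤_ q x
  shifts-weaken q≤q′ s = shifts λ p v σ →
    supp-mono (≤-trans (+-monoˡ-≤ p q≤q′)) (supp-act s p v σ)

  -- Scalars preserve degrees and generators raise them, so no element lowers a degree. This absorbs
  -- the multipliers in `shifts-ideal`.
  shifts-any : ∀ x → Shifts _≤_ 0 x
  shifts-any (κ r)   = shifts λ p v σ → supp-*ₗ r σ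
  shifts-any (e i)   = shifts λ p v σ →
    supp-wedge (f i) (supp-mono (λ p≤q → ≤-trans p≤q (n≤1+n _)) σ)
  shifts-any (x + y) = shifts λ p v σ →
    supp-+ (supp-act (shifts-any x) p v σ) (supp-act (shifts-any y) p v σ)
  shifts-any (x * y) = shifts λ p v σ → supp-act (shifts-any x) p _ (supp-act (shifts-any y) p v σ)
  shifts-any (- x)   = shifts λ p v σ → supp-neg (supp-act (shifts-any x) p v σ)

  shifts-ideal : ∀ q {g} {G : Pred Element g} →
    G ⊆ Shifts _≤_ q → Ideal ring G ⊆ Shifts _≤_ q
  shifts-ideal q G⊆S (generator g)     = G⊆S g
  shifts-ideal q G⊆S 0-closed          = shifts-0 q
  shifts-ideal q G⊆S (+-closed s t)    = shifts-+ q (shifts-ideal q G⊆S s) (shifts-ideal q G⊆S t)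
  shifts-ideal q G⊆S (*-closedˡ a s)   = shifts λ p v σ →
    supp-act (shifts-any a) _ _ (supp-act (shifts-ideal q G⊆S s) p v σ)
  shifts-ideal q G⊆S (*-closedʳ a s)   = shifts λ p v σ →
    supp-act (shifts-ideal q G⊆S s) p _ (supp-act (shifts-any a) p v σ)
  shifts-ideal q G⊆S (≈-closed x≈y s)  = shifts-≈ q x≈y (shifts-ideal q G⊆S s)

  -- `∂` removes one factor from a product of more than `q` generators, leaving at least `q`. The
  -- two summands are the two terms of the Leibniz rule.
  shifts-∂-product : ∀ q is → q < length is → Shifts _≤_ q (∂ (product is))
  shifts-∂-product q (i ∷ is) (s≤s q≤∣is∣) =
    shifts-+ q (shifts-≈ q (sym (*-identityˡ _)) (shifts-weaken q≤∣is∣ (shifts-product s≤s is)))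
               (tail-term q q≤∣is∣)
    where
    tail-term : ∀ q → q ≤ length is → Shifts _≤_ q (- e i * ∂ (product is))
    -- The tail may be empty here, so there is nothing to recurse on. For `suc q` the factor `e i`
    -- supplies one degree, and the boundary of the tail need only supply `q`.
    tail-term zero    _ = shifts-any (- e i * ∂ (product is))
    tail-term (suc q) q<∣is∣ = shifts λ p v σ →
      supp-neg (supp-act (shifts-e s≤s q i (shifts-∂-product q is q<∣is∣)) p v σ)

  -- On a vector of degree `p` the result lies in degree exactly `q + p` and also in degrees at
  -- least `suc q + p`, so it is zero; linearity extends this to all vectors.
  degree-shifts⇒annihilates : ∀ {q x} → Degree q x → Shifts _≤_ (suc q) x → Annihilates x
  degree-shifts⇒annihilates {q} {x} d s = homogeneous-induction (λ v → act x v ≈ᴹ 0ᴹ)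
    (λ v≈w xv≈0 → ≈ᴹ-trans (cong (≈ᴹ-sym v≈w)) xv≈0)
    (λ xv≈0 xw≈0 → ≈ᴹ-trans (+-homo _ _) (≈ᴹ-trans (+ᴹ-cong xv≈0 xw≈0) (+ᴹ-identityˡ 0ᴹ)))
    (λ p {v} σ → supp-disjoint (λ where ≡.refl → 1+n≰n)
      (supp-act (shifts-degree {_∼_ = _≡_} (≡.cong suc) d) p v σ)
      (supp-act s p v (supp-mono ≤-reflexive σ)))
    where open Linear (act-linear x)

  free-product : ∀ {a is} → All (a ≢_) (map f is) → Free a (act (product is) (vacuum k))
  free-product {a} {[]}     []        = free-resp a (≈ᴹ-sym (*ₗ-identityˡ _)) (free-vacuum a)
  free-product {a} {i ∷ is} (a≢ ∷ a∉) = free-wedge a (f i) a≢ (free-product a∉)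

  -- Generators are stripped off one at a time. As the labels are distinct, the remaining product is
  -- free of `f i`, so cancelling `f i` is legitimate; the empty product leaves the unit.
  product-vacuum≉0 : ¬ (CommutativeRing._≈_ R (CommutativeRing.1# R) (CommutativeRing.0# R)) →
    ∀ {is} → Unique (map f is) → ¬ (act (product is) (vacuum k) ≈ᴹ 0ᴹ)
  product-vacuum≉0 1≉0 {[]}     []          eq =
    vacuum≉0 1≉0 k (≈ᴹ-trans (≈ᴹ-sym (*ₗ-identityˡ _)) eq)
  product-vacuum≉0 1≉0 {i ∷ is} (fi∉ ∷ is!) eq =
    product-vacuum≉0 1≉0 is! (wedge-injective-free (f i) (free-product fi∉) eq)

-- Repeated generators and the boundary of a monomial.

module _ (R : CommutativeRing c ℓ) (n : ℕ) where
  open Exterior R n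
  private module E = Ring ring
  open RingProperties ring using (-0#≈0#; -‿distribˡ-*)

  e-repeated : ∀ i x → e i * (e i * x) ≈ 0#
  e-repeated i x = trans (sym (*-assoc _ _ _)) (trans (E.*-congʳ (e-square i)) (E.zeroˡ x))

  e-repeated-skip : ∀ i j x → e i * (e j * (e i * x)) ≈ 0#
  e-repeated-skip i j x = begin
    e i * (e j * (e i * x))     ≈⟨ *-assoc _ _ _ ⟨
    (e i * e j) * (e i * x)     ≈⟨ E.*-congʳ (e-anticomm i j) ⟩
    - (e j * e i) * (e i * x)   ≈⟨ -‿distribˡ-* _ _ ⟨
    - ((e j * e i) * (e i * x)) ≈⟨ neg-cong (*-assoc _ _ _) ⟩
    - (e j * (e i * (e i * x))) ≈⟨ neg-cong (E.*-congˡ (e-repeated i x)) ⟩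
    - (e j * 0#)                ≈⟨ neg-cong (E.zeroʳ _) ⟩
    - 0#                        ≈⟨ -0#≈0# ⟩
    0#                          ∎
    where open SetoidReasoning E.setoid

  -- The Leibniz rule applied to e i * (e i * x) ≈ 0#.
  e*∂ : ∀ i x → e i * ∂ (e i * x) ≈ e i * x
  e*∂ i x = begin
    e i * ∂ (e i * x)          ≈⟨ E.+-identityˡ _ ⟨
    0# + e i * ∂ (e i * x)     ≈⟨ E.+-congʳ ∂≈0 ⟨
    ((1# * (e i * x)) + - e i * ∂ (e i * x)) + e i * ∂ (e i * x)
      ≈⟨ +-assoc _ _ _ ⟩
    1# * (e i * x) + (- e i * ∂ (e i * x) + e i * ∂ (e i * x))
      ≈⟨ +-cong (*-identityˡ _) (trans (E.+-congʳ (sym (-‿distribˡ-* _ _))) (neg-inverseˡ _)) ⟩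
    e i * x + 0#               ≈⟨ E.+-identityʳ _ ⟩
    e i * x                    ∎
    where
    open SetoidReasoning E.setoid
    ∂≈0 : ∂ (e i * (e i * x)) ≈ 0#
    ∂≈0 = ∂-cong (e-repeated i x)

-- Vanishing and nonvanishing of boundaries under a labelling.

module _ (R : CommutativeRing c ℓ) {n k : ℕ} (f : Fin n → Fin k) where
  open Exterior R n
  open Module (ExteriorModule.Λ R k) using (≈ᴹ-trans; *ₗ-zeroˡ)
  open Action R f

  -- The action of e i depends on f i only, so equal labels may be replaced
  -- by equal generators, for which the product vanishes.
  ∂-triple-annihilates : ∀ i j l → f i ≡ f j ⊎ f i ≡ f l ⊎ f j ≡ f l →
    Annihilates (∂ (product (i ∷ j ∷ l ∷ [])))
  ∂-triple-annihilates i j l (inj₁ fi≡fj) v rewrite fi≡fj =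
    ≈ᴹ-trans (act-cong (∂-cong (e-repeated R n j (e l * 1#))) v) (*ₗ-zeroˡ v)
  ∂-triple-annihilates i j l (inj₂ (inj₁ fi≡fl)) v rewrite fi≡fl =
    ≈ᴹ-trans (act-cong (∂-cong (e-repeated-skip R n l j 1#)) v) (*ₗ-zeroˡ v)
  ∂-triple-annihilates i j l (inj₂ (inj₂ fj≡fl)) v rewrite fj≡fl =
    ≈ᴹ-trans (act-cong (∂-cong ill≈0) v) (*ₗ-zeroˡ v)
    where
    ill≈0 : e i * (e l * (e l * 1#)) ≈ 0#
    ill≈0 = trans (*-cong refl (e-repeated R n l 1#)) (Ring.zeroʳ ring (e i))

  -- By `e*∂`, multiplying the boundary by `e i` restores the monomial, so a vanishing boundary
  -- would make the monomial vanish on the unit.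
  ∂-product-vacuum≉0 : ¬ (CommutativeRing._≈_ R (CommutativeRing.1# R) (CommutativeRing.0# R)) →
    ∀ i is → Unique (map f (i ∷ is)) → ¬ Annihilates (∂ (product (i ∷ is)))
  ∂-product-vacuum≉0 1≉0 i is is! ∂≈0 = product-vacuum≉0 1≉0 is!
    (≈ᴹ-trans (act-cong (sym (e*∂ R n i (product is))) _)
      (≈ᴹ-trans (cong (∂≈0 _)) 0-homo))
    where open Linear (act-linear (e i))

-- The Orlik-Solomon ideal under the labelling by parts.

module _ (R : CommutativeRing c ℓ) {n : ℕ} (M : Matroid n) (simple : Matroid.Simple M)
         (π : Partition n) where
  open Exterior R n
  open Matroid M
  open Partition π

  block : Fin n → Fin size
  block x = proj₁ (covering x)

  ∈-block : ∀ x → x ∈ˢ part (block x)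
  ∈-block x = proj₂ (covering x)

  block-unique : ∀ {x b} → x ∈ˢ part b → block x ≡ b
  block-unique x∈b = disjoint (∈-block _) x∈b

  open Action R block

  module _ (independent₃ : PIndependentPartition M 3 π) where

    -- The cases follow the length of a list containing `S`. Up to two entries, `hereditary`
    -- together with `⊥-independent` or simplicity contradicts dependence; only three entries call
    -- on the partition.
    dependent-shifts : ∀ {S} → Dependent S → ∀ is → Unique is →
      (∀ {x} → x ∈ˢ S → x ∈ is) → Shifts _≤_ 3 (∂ (product is))
    dependent-shifts dep [] _ S⊆ =
      ⊥-elim (dep (hereditary (λ x∈ → ⊥-elim (¬Any[] (S⊆ x∈))) ⊥-independent))
    dependent-shifts dep (i ∷ []) _ S⊆ =
      ⊥-elim (proj₁ simple i λ ind → dep (hereditary S⊆i ind))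
      where
      S⊆i : ∀ {x} → x ∈ˢ _ → x ∈ˢ ⁅ i ⁆
      S⊆i x∈ with here ≡.refl ← S⊆ x∈ = x∈⁅x⁆ i
    dependent-shifts {S} dep (i ∷ j ∷ []) ((i≢j ∷ _) ∷ _) S⊆ =
      ⊥-elim (proj₂ simple i j (i≢j , proj₁ simple i , proj₁ simple j , λ ind →
        dep (hereditary S⊆ij ind)))
      where
      S⊆ij : ∀ {x} → x ∈ˢ S → x ∈ˢ ⁅ i ⁆ ∪ ⁅ j ⁆
      S⊆ij x∈ with S⊆ x∈
      ... | here ≡.refl         = x∈p∪q⁺ (inj₁ (x∈⁅x⁆ i))
      ... | there (here ≡.refl) = x∈p∪q⁺ (inj₂ (x∈⁅x⁆ j))
    dependent-shifts {S} dep (i ∷ j ∷ l ∷ []) _ S⊆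
      with block i ≟ block j | block i ≟ block l | block j ≟ block l
    ... | yes p | _     | _     =
      annihilates⇒shifts 3 (∂-triple-annihilates R block i j l (inj₁ p))
    ... | no _  | yes p | _     =
      annihilates⇒shifts 3 (∂-triple-annihilates R block i j l (inj₂ (inj₁ p)))
    ... | no _  | no _  | yes p =
      annihilates⇒shifts 3 (∂-triple-annihilates R block i j l (inj₂ (inj₂ p)))
    -- Three different parts: `independent₃` makes the three entries independent, and `S` is
    -- contained in them.
    ... | no i≁j | no i≁l | no j≁l = ⊥-elim (dep (hereditary
      (λ x∈ → ≡.subst (_∈ˢ _) (≡.sym (lookup-index (S⊆ x∈))) (∈-⋃-singletons⁺ x (index (S⊆ x∈))))
      (independent₃ ≤-refl (block ∘ x) injective x (∈-block ∘ x))))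
      where
      x : Fin 3 → Fin n
      x = lookup (i ∷ j ∷ l ∷ [])
      injective : ∀ {a b} → block (x a) ≡ block (x b) → a ≡ b
      injective {zero}           {zero}           _ = ≡.refl
      injective {zero}           {suc zero}       p = ⊥-elim (i≁j p)
      injective {zero}           {suc (suc zero)} p = ⊥-elim (i≁l p)
      injective {suc zero}       {zero}           p = ⊥-elim (i≁j (≡.sym p))
      injective {suc zero}       {suc zero}       _ = ≡.refl
      injective {suc zero}       {suc (suc zero)} p = ⊥-elim (j≁l p)
      injective {suc (suc zero)} {zero}           p = ⊥-elim (i≁l (≡.sym p))
      injective {suc (suc zero)} {suc zero}       p = ⊥-elim (j≁l (≡.sym p))
      injective {suc (suc zero)} {suc (suc zero)} _ = ≡.refl
    -- With four or more factors the length alone puts the boundary in degree at least 3.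
    dependent-shifts dep is@(_ ∷ _ ∷ _ ∷ _ ∷ _) _ _ =
      shifts-∂-product 3 is (s≤s (s≤s (s≤s (s≤s z≤n))))

    orlikSolomon-shifts : OrlikSolomonIdeal R M ⊆ Shifts _≤_ 3
    orlikSolomon-shifts = shifts-ideal 3 λ (S , dep , x≈∂e) →
      shifts-≈ 3 (sym x≈∂e) (dependent-shifts dep (elements S) (elements-unique S) (∈-elements⁺ S))

    -- The quadratic generators have degree 2 and, lying in the ideal, raise degrees by at least 3,
    -- so they act as zero; the ideal that they generate then does too.
    orlikSolomon-annihilates : Quadratic R M → OrlikSolomonIdeal R M ⊆ Annihilates
    orlikSolomon-annihilates (I⊆I₂ , _) = annihilates-ideal
      (λ (x∈I , deg2) → degree-shifts⇒annihilates deg2 (orlikSolomon-shifts x∈I)) ∘ I⊆I₂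

-- Independence of transversals of the parts.

theorem4p3 : ∀ {c ℓ} (R : CommutativeRing c ℓ) →
    ¬ (CommutativeRing._≈_ R (CommutativeRing.1# R) (CommutativeRing.0# R)) →
    ∀ {n : ℕ} (M : Matroid n) (r : ℕ) →
    Matroid.Simple M → Matroid.HasRank M r → 3 ≤ r →
    Quadratic R M → PIndependent M r 3
theorem4p3 R 1≉0 {n} M r simple _ _ quadratic π independent₃ {m} _ B B-injective x x∈B =
  -- If `S` were dependent, `∂ e[ S ]` would be a generator of the ideal and act as zero, contrary
  -- to `nonvanishing`.
  decidable-stable (independent? S) λ dep →
    nonvanishing dep (elements S) (elements-unique S) (∈-elements⁺ S) (∈-elements⁻ S)
      (orlikSolomon-annihilates R M simple π independent₃ quadratic
        (generator (S , dep , Exterior.refl)))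
  where
  open Matroid M
  open Exterior R n using (∂; product)
  S : Subset n
  S = ⋃ (tabulate λ a → ⁅ x a ⁆)

  -- Disjointness of the parts identifies `block (x a)` with `B a`, and `B` is injective.
  block-injective : ∀ {y z} → y ∈ˢ S → z ∈ˢ S →
    block R M simple π y ≡ block R M simple π z → y ≡ z
  block-injective y∈ z∈ eq
    with a , ≡.refl ← ∈-⋃-singletons⁻ x y∈ | b , ≡.refl ← ∈-⋃-singletons⁻ x z∈ =
    ≡.cong x (B-injective (≡.trans (≡.sym (block-unique R M simple π (x∈B a)))
      (≡.trans eq (block-unique R M simple π (x∈B b)))))

  nonvanishing : Dependent S → ∀ is → Unique is →
    (∀ {y} → y ∈ˢ S → y ∈ is) → (∀ {y} → y ∈ is → y ∈ˢ S) →
    ¬ Action.Annihilates R (block R M simple π) (∂ (product is))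
  -- The boundary of the empty product is zero, so here the contradiction comes from the
  -- independence of the empty set.
  nonvanishing dep [] _ S⊆ _ _ = dep (hereditary (λ y∈ → ⊥-elim (¬Any[] (S⊆ y∈))) ⊥-independent)
  nonvanishing dep (i ∷ is) is! _ ⊆S = ∂-product-vacuum≉0 R (block R M simple π) 1≉0 i is
    (unique-map _ (λ y∈ z∈ → block-injective (⊆S y∈) (⊆S z∈)) is!)
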